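{- Let $n,k$ be positive integers with $k\le\lceil n/2\rceil$. Then $K_n$ has a balanced Gallai $k$-coloring.
   Context: A Gallai $k$-coloring of the complete graph $K_n$ is an assignment of one of the colors $1,\dots,k$ to each edge of $K_n$ (adjacent edges may have the same color) such that no triangle has its three edges colored with three pairwise different colors. Let the numbers of edges in the $k$ color classes, listed in non-increasing order, be $e_1\ge e_2\ge\dots\ge e_k$ (so $\sum_{i=1}^k e_i=\binom{n}{2}$). The coloring is called balanced if $e_1-e_k\le 1$. -}

module Defs where

open import Data.Fin.Base using (Fin; zero; fromℕ; cast)
open import Data.Fin.Properties using (_≟_; _<?_)
open import Data.List.Base
  using (List; length; lookup; map; filter; allFin; cartesianProduct)
open import Data.List.Properties using (length-map; length-tabulate)
open import Data.List.Relation.Binary.Permutation.Propositional.Properties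
  using (↭-length)
open import Data.Nat.Base as ℕ using (ℕ; suc; NonZero; _∸_)
open import Data.Nat.Properties using (≤-decTotalOrder)
open import Data.Product.Base using (_×_; _,_)
open import Function.Base using (id)
open import Relation.Binary.Construct.Flip.EqAndOrd using (decTotalOrder)
open import Relation.Binary.PropositionalEquality
  using (_≡_; _≢_; sym; trans)
open import Relation.Nullary.Negation.Core using (¬_)

open import Data.List.Sort (decTotalOrder ≤-decTotalOrder)
  using (sort; sort-↭)

-- Kₙ has no loops, so the values `color i i` carry no meaning: nothing
-- below depends on them.
record Coloring (n k : ℕ) : Set where
  field
    color     : Fin n → Fin n → Fin k
    color-sym : ∀ i j → color i j ≡ color j i

open Coloring public

Gallai : ∀ {n k} → Coloring n k → Set
Gallai {n} c = ∀ (x y z : Fin n) → x ≢ y → y ≢ z → x ≢ z →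
  ¬ (color c x y ≢ color c y z × color c y z ≢ color c x z ×
     color c x y ≢ color c x z)

-- The edge {i , j} is listed once, as (i , j) with i < j.
edges : ∀ n → List (Fin n × Fin n)
edges n = filter (λ (i , j) → i <? j) (cartesianProduct (allFin n) (allFin n))

classSize : ∀ {n k} → Coloring n k → Fin k → ℕ
classSize {n} c a = length (filter (λ (i , j) → color c i j ≟ a) (edges n))

-- `sort` is taken with respect to the flipped order on ℕ, so the result
-- is non-increasing.
sortedSizes : ∀ {n k} → Coloring n k → List ℕ
sortedSizes {k = k} c = sort (map (classSize c) (allFin k))

length-sortedSizes : ∀ {n k} (c : Coloring n k) → length (sortedSizes c) ≡ k
length-sortedSizes {k = k} c =
  trans (↭-length (sort-↭ (map (classSize c) (allFin k))))
    (trans (length-map (classSize c) (allFin k)) (length-tabulate id))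

-- Indices are shifted by one: e c i is the (i+1)-st largest class size.
e : ∀ {n k} → Coloring n k → Fin k → ℕ
e c i = lookup (sortedSizes c) (cast (sym (length-sortedSizes c)) i)

-- The first entry is at least the last, so the truncated subtraction is exact.
Balanced : ∀ {n k} .{{_ : NonZero k}} → Coloring n k → Set
Balanced {k = suc m} c = e c zero ∸ e c (fromℕ m) ℕ.≤ 1

{-# OPTIONS --safe #-}
module Submission where

open import Defs
open import Data.Bool.Base using (true; false; T; if_then_else_)
open import Data.Fin.Base using (Fin; toℕ; fromℕ; fromℕ<; cast)
open import Data.Fin.Properties
  using (_≟_; _<?_; toℕ-injective; toℕ-fromℕ<; toℕ<n; fromℕ<-cong)
open import Data.List.Base
  using (List; []; _∷_; _++_; [_]; map; length; replicate; lookup; filter; allFin;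
         tabulate; cartesianProduct)
open import Data.List.Membership.Propositional.Properties using (∈-lookup)
open import Data.List.Properties
  using (++-assoc; ++-identityʳ; ∷-injectiveˡ; ∷-injectiveʳ; map-++; map-∘; map-tabulate;
         map-replicate; length-++; length-replicate; tabulate-cong)
open import Data.List.Relation.Binary.Permutation.Propositional
  using (_↭_; module _↭_; refl; prep; swap; ↭-trans; ↭-sym; ↭-reflexive;
         module PermutationReasoning)
import Data.List.Relation.Binary.Permutation.Propositional.Properties as ↭
open import Data.List.Relation.Unary.All as All using (All; _∷_)
open import Data.List.Relation.Unary.All.Properties using (++⁺; replicate⁺; map⁺)
open import Data.Nat.Base
open import Data.Nat.DivMod using (m≡m%n+[m/n]*n; m%n<n; /-monoˡ-≤; m*n/n≡m)
open import Data.Nat.Induction using (<-wellFounded)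
open import Data.Nat.ListAction using (sum)
open import Data.Nat.ListAction.Properties using (sum-++; sum-↭)
open import Data.Nat.Properties hiding (_≟_; _<?_)
open import Data.Nat.Tactic.RingSolver using (solve-∀)
open import Data.Product.Base using (_×_; _,_; ∃-syntax; Σ-syntax; proj₁; proj₂; map₂)
open import Data.Sum.Base using (_⊎_; inj₁; inj₂)
open import Data.Unit.Base using (tt)
open import Function.Base using (id; _∘_)
open import Induction.WellFounded using (Acc; acc)
open import Relation.Binary.Construct.Flip.EqAndOrd using (decTotalOrder)
open import Relation.Binary.PropositionalEquality
  using (_≡_; _≢_; refl; sym; trans; cong; cong₂; subst; subst₂; module ≡-Reasoning)
open import Relation.Nullary using (does; yes; no)
open import Relation.Nullary.Negation using (contradiction)
open import Relation.Unary using (Decidable)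

open import Algebra.Properties.CommutativeMonoid.Sum +-0-commutativeMonoid
  using (∑-comm; sum-replicate-zero; sum-cong-≗) renaming (sum to ∑)
open import Data.List.Sort (decTotalOrder ≤-decTotalOrder) using (sort-↭)

-- Number the vertices 0, …, n − 1 and colour each edge by a colour attached to its larger
-- endpoint. Every such colouring is Gallai, and vertex j contributes j edges to its colour, so
-- it suffices to distribute 0, …, n − 1 over k bins with sums q or q + 1. If n = 2k − 1, take n − 1
-- alone and pair up the others. If 2k ≤ n, then q ≥ n − 1, and this suffices by induction on n:
--   * if the bins are large, give each of them two of the top 2k numbers, with constant sum;
--   * otherwise let t be the odd and u the even one of q, q + 1. The numbers from t − n + 1 to
--     n − 1 form pairs of sum t. If there are too few t-bins for this, all t-bins are filled by
--     inner pairs, u-bins by outer pairs, and one number h remains. The next u-bin takes h, and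
--     it remains to fill equal bins and one bin of arbitrary size.
-- Equal bins of size a together with one bin of arbitrary size w are treated likewise; if a is
-- even, the pairing leaves the number a / 2, and all open bins of size a are cut into halves.

private
  variable
    xs ys zs ts us : List ℕ

-- Splitting a list of numbers into bins of prescribed sums

-- Numbers count only up to permutation: each `fill` carries its own `↭`, so the contents of a bin
-- may be taken from anywhere in the list.
data Part : List ℕ → List ℕ → Set where
  empty : Part [] []
  fill  : ∀ {t} ys → sum ys ≡ t → ys ++ xs ↭ zs → Part xs ts → Part zs (t ∷ ts)

Part-↭ˡ : xs ↭ ys → Part xs ts → Part ys ts
Part-↭ˡ σ empty with refl ← ↭.↭-empty-inv (↭-sym σ) = empty
Part-↭ˡ σ (fill ws eq τ p) = fill ws eq (↭-trans τ σ) p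

Part-↭ʳ : ts ↭ us → Part xs ts → Part xs us
Part-↭ʳ refl p = p
Part-↭ʳ (prep _ σ) (fill ws eq τ p) = fill ws eq τ (Part-↭ʳ σ p)
Part-↭ʳ (swap _ _ σ) (fill vs eq τ (fill ws eq′ τ′ p)) =
  fill ws eq′ (↭-trans (↭.shifts ws vs) (↭-trans (↭.++⁺ˡ vs τ′) τ))
    (fill vs eq refl (Part-↭ʳ σ p))
Part-↭ʳ (_↭_.trans σ τ) p = Part-↭ʳ τ (Part-↭ʳ σ p)

Part-sum : Part xs ts → sum xs ≡ sum ts
Part-sum empty = refl
Part-sum (fill {xs = xs} ys refl τ p) =
  trans (sym (sum-↭ τ)) (trans (sum-++ ys xs) (cong (sum ys +_) (Part-sum p)))

Part-++ : Part xs ts → Part ys us → Part (xs ++ ys) (ts ++ us)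
Part-++ empty q = q
Part-++ {ys = ys} (fill {xs = xs} ws eq τ p) q =
  fill ws eq (↭-trans (↭-reflexive (sym (++-assoc ws xs ys))) (↭.++⁺ʳ ys τ)) (Part-++ p q)

single : ∀ {t} xs → sum xs ≡ t → Part xs [ t ]
single xs eq = fill xs eq (↭-reflexive (++-identityʳ xs)) empty

zeros : ∀ k → Part [] (replicate k 0)
zeros zero = empty
zeros (suc k) = fill [] refl refl (zeros k)

merge : ∀ {s t} → Part xs (s ∷ t ∷ ts) → Part xs (s + t ∷ ts)
merge (fill vs refl τ (fill {xs = xs} ws refl τ′ p)) =
  fill (vs ++ ws) (sum-++ vs ws)
    (↭-trans (↭-reflexive (++-assoc vs ws xs)) (↭-trans (↭.++⁺ˡ vs τ′) τ)) p

-- `ys` first becomes a bin of its own, which is then merged with the first bin.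
pour : ∀ {s t} ys → s + sum ys ≡ t → Part xs (s ∷ ts) → Part (xs ++ ys) (t ∷ ts)
pour {xs = xs} ys refl p = merge (Part-↭ˡ (↭.++-comm ys xs) (fill-comm p))
  where
  fill-comm : ∀ {s} → Part xs (s ∷ ts) → Part (ys ++ xs) (s ∷ sum ys ∷ ts)
  fill-comm p = Part-↭ʳ (swap _ _ refl) (fill ys refl refl p)

-- Used to undo the cutting of bins into halves.
mergePairs : ∀ k c → Part xs (replicate (k + k) c ++ us) → Part xs (replicate k (c + c) ++ us)
mergePairs zero c p = p
mergePairs (suc k) c p rewrite +-suc k k with merge p
... | fill ws eq τ q = fill ws eq τ (mergePairs k c q)

-- The two partitions are joined bin by bin. This is how each large bin receives a pair of constant
-- sum `S`.
raise : ∀ {S} → Part xs ts → Part ys (replicate (length ts) S) →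
        Part (xs ++ ys) (map (_+ S) ts)
raise empty q = q
raise {S = S} (fill {xs = xs} vs refl τ p) (fill {xs = ys} ws eq′ τ′ q) =
  fill (vs ++ ws) (trans (sum-++ vs ws) (cong (sum vs +_) eq′)) perm (raise p q)
  where
  open PermutationReasoning
  perm : (vs ++ ws) ++ (xs ++ ys) ↭ _
  perm = begin
    (vs ++ ws) ++ (xs ++ ys)   ≡⟨ ++-assoc vs ws (xs ++ ys) ⟩
    vs ++ (ws ++ (xs ++ ys))   ↭⟨ ↭.++⁺ˡ vs (↭.shifts ws xs) ⟩
    vs ++ (xs ++ (ws ++ ys))   ≡⟨ ++-assoc vs xs (ws ++ ys) ⟨
    (vs ++ xs) ++ (ws ++ ys)   ↭⟨ ↭.++⁺ τ τ′ ⟩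
    _ ∎

replicate-+ : ∀ m n (x : ℕ) → replicate (m + n) x ≡ replicate m x ++ replicate n x
replicate-+ zero n x = refl
replicate-+ (suc m) n x = cong (x ∷_) (replicate-+ m n x)

sum-replicate : ∀ n x → sum (replicate n x) ≡ n * x
sum-replicate zero x = refl
sum-replicate (suc n) x = cong (x +_) (sum-replicate n x)

-- Intervals

range : ℕ → ℕ → List ℕ
range lo zero = []
range lo (suc n) = lo ∷ range (suc lo) n

range-++ : ∀ lo m n → range lo (m + n) ≡ range lo m ++ range (lo + m) n
range-++ lo zero n rewrite +-identityʳ lo = refl
range-++ lo (suc m) n rewrite +-suc lo m = cong (lo ∷_) (range-++ (suc lo) m n)

tri : ℕ → ℕ
tri n = sum (range 0 n)

-- The closed form n(n - 1)/2, stated without division or subtraction. The induction needs an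
-- arbitrary lower end, since `range` recurses on it.
tri-closed : ∀ n → tri n + tri n + n ≡ n * n
tri-closed = go 0
  where
  go : ∀ lo n → sum (range lo n) + sum (range lo n) + n ≡ (lo + lo + n) * n
  go lo zero = sym (*-zeroʳ (lo + lo + 0))
  go lo (suc n) = trans (lem₁ lo (sum (range (suc lo) n)) n)
    (trans (cong (λ z → z + (lo + lo + 1)) (go (suc lo) n)) (lem₂ lo n))
    where
    lem₁ : ∀ lo s n → (lo + s) + (lo + s) + suc n ≡ s + s + n + (lo + lo + 1)
    lem₁ = solve-∀
    lem₂ : ∀ lo n → (suc lo + suc lo + n) * n + (lo + lo + 1) ≡ (lo + lo + suc n) * suc n
    lem₂ = solve-∀

tri-+ : ∀ m n → tri (m + n) ≡ tri m + sum (range m n)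
tri-+ m n = trans (cong sum (range-++ 0 m n)) (sum-++ (range 0 m) (range m n))

-- Smallest with largest, second smallest with second largest, and so on: `s` nested pairs, each of
-- sum `v`, surround a middle interval of `M` numbers that is partitioned separately.
nest : ∀ s lo M v → suc v ≡ lo + (lo + (s + (M + s))) → Part (range (lo + s) M) us →
       Part (range lo (s + (M + s))) (us ++ replicate s v)
nest {us = us} zero lo M v _ p rewrite +-identityʳ M | +-identityʳ lo | ++-identityʳ us = p
nest {us = us} (suc s) lo M v eq p rewrite +-suc lo s =
  Part-↭ʳ (↭-sym (↭.shift v us (replicate s v)))
    (fill (lo ∷ lo + suc (s + (M + s)) ∷ []) sum-eq perm (nest s (suc lo) M v eq′ p))
  where
  sum-eq : lo + (lo + suc (s + (M + s)) + 0) ≡ v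
  sum-eq = suc-injective (trans (lem lo s M) (sym eq))
    where
    lem : ∀ lo s M → suc (lo + (lo + suc (s + (M + s)) + 0)) ≡ lo + (lo + suc (s + (M + suc s)))
    lem = solve-∀
  eq′ : suc v ≡ suc lo + (suc lo + (s + (M + s)))
  eq′ = trans eq (lem lo s M)
    where
    lem : ∀ lo s M → lo + (lo + suc (s + (M + suc s))) ≡ suc lo + (suc lo + (s + (M + s)))
    lem = solve-∀
  len : suc (s + (M + suc s)) ≡ suc ((s + (M + s)) + 1)
  len = lem s M
    where
    lem : ∀ s M → suc (s + (M + suc s)) ≡ suc ((s + (M + s)) + 1)
    lem = solve-∀
  open PermutationReasoning
  perm : lo ∷ lo + suc (s + (M + s)) ∷ range (suc lo) (s + (M + s))
         ↭ range lo (suc (s + (M + suc s)))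
  perm = begin
    lo ∷ lo + suc (s + (M + s)) ∷ range (suc lo) (s + (M + s))
      ↭⟨ prep lo (↭.∷↭∷ʳ _ _) ⟩
    lo ∷ range (suc lo) (s + (M + s)) ++ [ lo + suc (s + (M + s)) ]
      ≡⟨ cong (λ z → lo ∷ range (suc lo) (s + (M + s)) ++ [ z ]) (+-suc lo _) ⟩
    lo ∷ range (suc lo) (s + (M + s)) ++ [ suc lo + (s + (M + s)) ]
      ≡⟨ cong (lo ∷_) (range-++ (suc lo) (s + (M + s)) 1) ⟨
    range lo (suc ((s + (M + s)) + 1))
      ≡⟨ cong (range lo) len ⟨
    range lo (suc (s + (M + suc s))) ∎

-- Bins that are all equal, except one

half : ∀ n → ∃[ h ] (n ≡ h + h ⊎ n ≡ suc (h + h))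
half zero = 0 , inj₁ refl
half (suc n) with half n
... | h , inj₁ eq = h , inj₂ (cong suc eq)
... | h , inj₂ eq = suc h , inj₁ (trans (cong suc eq) (cong suc (sym (+-suc h h))))

append : ∀ {t} n L → Part (range 0 n) (t ∷ ts) → Part (range n L) us →
         Part (range 0 (n + L)) (t ∷ ts ++ us)
append n L p q = subst (λ zs → Part zs _) (sym (range-++ 0 n L)) (Part-++ p q)

pourTop : ∀ {s t} n → s + n ≡ t → Part (range 0 n) (s ∷ ts) → Part (range 0 (suc n)) (t ∷ ts)
pourTop {s = s} n eq p =
  subst (λ zs → Part zs _) (trans (sym (range-++ 0 n 1)) (cong (range 0) (+-comm n 1)))
    (pour [ n ] (trans (cong (s +_) (+-identityʳ n)) eq) p)

-- The top `k + k` numbers form `k` pairs of sum `S`. Each bin of `ts` takes one pair, and the bin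
-- `w` takes none.
lift : ∀ {w S} x k → length ts ≡ k → suc S ≡ x + (x + (k + k)) → Part (range 0 x) (w ∷ ts) →
       Part (range 0 (x + (k + k))) (w ∷ map (_+ S) ts)
lift {S = S} x k refl eq (fill {xs = ys} ws e τ p) =
  subst (λ zs → Part zs _) (sym (range-++ 0 x (k + k)))
    (fill ws e (↭-trans (↭-reflexive (sym (++-assoc ws ys _))) (↭.++⁺ʳ _ τ))
      (raise p (nest k x 0 S eq empty)))

tri-block : ∀ {n L} → Part (range n L) us → tri (n + L) ≡ tri n + sum us
tri-block {n = n} {L} p = trans (tri-+ n L) (cong (tri n +_) (Part-sum p))

tri-lift : ∀ S x k → suc S ≡ x + (x + (k + k)) → tri (x + (k + k)) ≡ tri x + k * S
tri-lift S x k eq =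
  trans (tri-block (nest k x 0 S eq empty)) (cong (tri x +_) (sum-replicate k S))

tri-double : ∀ m → tri (suc m) + tri (suc m) ≡ suc m * m
tri-double m = +-cancelʳ-≡ (suc m) _ _ (trans (tri-closed (suc m)) (lem m))
  where
  lem : ∀ m → suc m * suc m ≡ suc m * m + suc m
  lem = solve-∀

-- With `r < N` the bins would hold less than `(r + 1) * a ≤ N * a`. So there is a bin for each of
-- the `N` pairs of a block.
blockFits : ∀ N r a w X → r * a + w ≡ X + N * a → w < a → N ≤ r
blockFits N r a w X eq w<a = ≮⇒≥ λ r<N → <-irrefl eq (begin-strict
  r * a + w  <⟨ +-monoʳ-< (r * a) w<a ⟩
  r * a + a  ≡⟨ +-comm (r * a) a ⟩
  suc r * a  ≤⟨ *-monoˡ-≤ a r<N ⟩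
  N * a      ≤⟨ m≤n+m (N * a) X ⟩
  X + N * a  ∎)
  where open ≤-Reasoning

-- As `a` is odd, the numbers from `n` on split into `N` pairs of sum `a` with no middle number;
-- `rec` fills the remaining bins from the numbers below `n`.
oddStep : ∀ n N r a w → suc a ≡ n + (n + (N + N)) → w < a → r * a + w ≡ tri (n + (N + N)) →
  (∀ r′ → r′ * a + w ≡ tri n → Part (range 0 n) (w ∷ replicate r′ a)) →
  Part (range 0 (n + (N + N))) (w ∷ replicate r a)
oddStep n N r a w aeq w<a eq rec
  with r′ , refl ← m≤n⇒∃[o]m+o≡n (blockFits N r a w (tri n) (trans eq (tri-lift a n N aeq)) w<a) =
  Part-↭ʳ (prep w (↭-trans (↭.++-comm (replicate r′ a) (replicate N a))
                           (↭-reflexive (sym (replicate-+ N r′ a)))))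
    (append n (N + N) (rec r′ eq′) (nest N n 0 a aeq empty))
  where
  lem : ∀ N r′ a w → (N + r′) * a + w ≡ r′ * a + w + N * a
  lem = solve-∀
  eq′ : r′ * a + w ≡ tri n
  eq′ = +-cancelʳ-≡ (N * a) _ _ (trans (sym (lem N r′ a w)) (trans eq (tri-lift a n N aeq)))

-- If `2r ≥ m + 1`, then twice the total would be at least `(m + 1) * a`, more than `(m + 1) * m`.
-- Hence there are two numbers for each of the `r` bins and at least one more.
twiceBins≤top : ∀ r m a w → m < a → r * a + w ≡ tri (suc m) → r + r ≤ m
twiceBins≤top r m a w m<a eq = ≮⇒≥ λ m<2r → <-irrefl (sym (tri-double m)) (begin-strict
  suc m * m                  <⟨ *-monoʳ-< (suc m) m<a ⟩
  suc m * a                  ≤⟨ *-monoˡ-≤ a m<2r ⟩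
  (r + r) * a                ≡⟨ *-distribʳ-+ a r r ⟩
  r * a + r * a              ≤⟨ +-mono-≤ (m≤m+n (r * a) w) (m≤m+n (r * a) w) ⟩
  (r * a + w) + (r * a + w)  ≡⟨ cong (λ z → z + z) eq ⟩
  tri (suc m) + tri (suc m)  ∎)
  where open ≤-Reasoning

-- The middle element c is half of the bin size a = c + c. One bin takes c and still needs c;
-- cutting the other open bins into halves keeps all of them equal.
evenStep : ∀ n N r w → let c = n + N in
  w < c + c → r * (c + c) + w ≡ tri (n + (N + suc N)) →
  (∀ r′ → r′ * c + w ≡ tri n → Part (range 0 n) (w ∷ replicate r′ c)) →
  Part (range 0 (n + (N + suc N))) (w ∷ replicate r (c + c))
evenStep n N r w w<a eq rec = finish (m≤n⇒∃[o]m+o≡n N≤r)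
  where
  c = n + N
  aeq : suc (c + c) ≡ n + (n + (N + suc N))
  aeq = lem n N
    where
    lem : ∀ n N → suc ((n + N) + (n + N)) ≡ n + (n + (N + suc N))
    lem = solve-∀
  block : Part (range n (N + suc N)) (c ∷ replicate N (c + c))
  block = nest N n 1 (c + c) aeq (single [ c ] (+-identityʳ c))
  total : tri (n + (N + suc N)) ≡ tri n + (c + N * (c + c))
  total = trans (tri-block block) (cong (λ z → tri n + (c + z)) (sum-replicate N (c + c)))
  N≤r : N ≤ r
  N≤r = blockFits N r (c + c) w (tri n + c)
    (trans eq (trans total (sym (+-assoc (tri n) c (N * (c + c)))))) w<a
  go : ∀ r′ → (N + r′) * (c + c) + w ≡ tri (n + (N + suc N)) →
       Part (range 0 (n + (N + suc N))) (w ∷ replicate (N + r′) (c + c))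
  -- The pairs fill all bins of size `c + c`; the numbers below `n` and the middle element `c` all
  -- go into the bin `w`.
  go zero eq rewrite +-identityʳ N =
    subst (λ z → Part (range 0 (n + (N + suc N))) (z ∷ replicate N (c + c))) (sym w-eq)
      (merge (append n (N + suc N) (single (range 0 n) refl) block))
    where
    lem : ∀ x y z → x + (y + z) ≡ z + (x + y)
    lem = solve-∀
    w-eq : w ≡ tri n + c
    w-eq = +-cancelˡ-≡ (N * (c + c)) _ _ (trans eq (trans total (lem (tri n) c (N * (c + c)))))
  go (suc r′) eq = Part-↭ʳ perm₂ (mergePairs (suc r′) c (Part-↭ʳ perm₁
      (append n (N + suc N) (rec (r′ + suc r′) eq′) block)))
    where
    lem : ∀ N r′ c w → (N + suc r′) * (c + c) + w ≡ ((r′ + suc r′) * c + w) + (c + N * (c + c))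
    lem = solve-∀
    eq′ : (r′ + suc r′) * c + w ≡ tri n
    eq′ = +-cancelʳ-≡ (c + N * (c + c)) _ _ (trans (sym (lem N r′ c w)) (trans eq total))
    R = replicate (r′ + suc r′) c
    Q = replicate N (c + c)
    S = replicate (suc r′) (c + c)
    open PermutationReasoning
    perm₁ : w ∷ R ++ c ∷ Q ↭ c ∷ R ++ w ∷ Q
    perm₁ = begin
      w ∷ R ++ c ∷ Q  ↭⟨ prep w (↭.shift c R Q) ⟩
      w ∷ c ∷ R ++ Q  ↭⟨ swap w c refl ⟩
      c ∷ w ∷ R ++ Q  ↭⟨ prep c (↭.shift w R Q) ⟨
      c ∷ R ++ w ∷ Q  ∎
    perm₂ : S ++ w ∷ Q ↭ w ∷ replicate (N + suc r′) (c + c)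
    perm₂ = begin
      S ++ w ∷ Q   ↭⟨ ↭.shift w S Q ⟩
      w ∷ S ++ Q   ↭⟨ prep w (↭.++-comm S Q) ⟩
      w ∷ Q ++ S   ≡⟨ cong (w ∷_) (replicate-+ N (suc r′) (c + c)) ⟨
      w ∷ replicate (N + suc r′) (c + c)  ∎
  finish : ∃[ r′ ] N + r′ ≡ r → Part (range 0 (n + (N + suc N))) (w ∷ replicate r (c + c))
  finish (r′ , refl) = go r′ eq

-- For n = 4r + 2 and a = 8r + 3 the numbers left by pairing are 0, …, 2r + 1, and the equal bins
-- still need only 2r, too little for the induction hypothesis: here 2r + 1 goes into the bin w.
exceptional : ∀ r n a w → n ≡ suc (r + suc r) + (r + r) →
  a ≡ r + r + (3 + (r + r + (r + r) + (r + r))) →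
  r * a + w ≡ tri n → Part (range 0 n) (w ∷ replicate r a)
exceptional r n a w refl refl eq =
  subst (λ z → Part (range 0 n) (z ∷ replicate r a)) w-eq bins
  where
  S = 3 + (r + r + (r + r) + (r + r))
  lem₁ : ∀ r → r + (r + suc r) ≡ r + suc (r + r)
  lem₁ = solve-∀
  lem₂ : ∀ r → suc (3 + (r + r + (r + r) + (r + r))) ≡ suc (r + suc r) + (suc (r + suc r) + (r + r))
  lem₂ = solve-∀
  bins : Part (range 0 n) (r + suc (r + r) ∷ replicate r a)
  bins = subst (λ z → Part (range 0 n) (r + suc (r + r) ∷ z)) (map-replicate (_+ S) r (r + r))
    (lift (suc (r + suc r)) r (length-replicate r) (lem₂ r)
      (pourTop (r + suc r) (lem₁ r)
        (nest r 0 1 (r + r) (sym (+-suc r r)) (single [ r ] (+-identityʳ r)))))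
  w-eq : r + suc (r + r) ≡ w
  w-eq = +-cancelʳ-≡ (r * a) _ _ (trans (cong (r + suc (r + r) +_) (sym (sum-replicate r a)))
    (trans (sym (Part-sum bins)) (trans (sym eq) (+-comm (r * a) w))))

-- Here a = 2m + 1 + d, where m = y + 2k is the largest number. Every bin of size `a` takes a pair
-- of sum `S` from the top `2k` numbers and still needs `a′`. The bound `y ≤ a′` required by the
-- induction fails only in the case of `exceptional`.
farStep : ∀ r y d w →
  let k = suc r
      n = suc y + (k + k)
      S = suc ((y + k) + (y + k))
      a′ = k + k + d
      a = a′ + S in
  w < y + (k + k) → k * a + w ≡ tri n →
  (y ≤ a′ → k * a′ + w ≡ tri (suc y) → Part (range 0 (suc y)) (w ∷ replicate k a′)) →
  Part (range 0 n) (w ∷ replicate k a)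
farStep r y d w w<m eq rec = cases (≤-<-connex y a′)
  where
  k = suc r
  n = suc y + (k + k)
  S = suc ((y + k) + (y + k))
  a′ = k + k + d
  a = a′ + S
  seq : suc S ≡ suc y + (suc y + (k + k))
  seq = lem r y
    where
    lem : ∀ r y → suc (suc ((y + suc r) + (y + suc r))) ≡ suc y + (suc y + (suc r + suc r))
    lem = solve-∀
  eq′ : k * a′ + w ≡ tri (suc y)
  eq′ = +-cancelʳ-≡ (k * S) _ _ (trans (sym (lem k a′ S w)) (trans eq (tri-lift S (suc y) k seq)))
    where
    lem : ∀ k a S w → k * (a + S) + w ≡ k * a + w + k * S
    lem = solve-∀
  -- `g` is the slack in `w < m`; substituting for `w` turns the equation for the total into one
  -- that `tight` can compare term by term.
  doubled : ∀ g → suc w + g ≡ y + (k + k) →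
    (k + k) * a + (y + (k + k) + (y + (k + k))) ≡ suc (y + (k + k)) * (y + (k + k)) + (2 + (g + g))
  doubled g geq = begin
    (k + k) * a + (y + (k + k) + (y + (k + k)))
      ≡⟨ cong (λ z → (k + k) * a + (z + z)) geq ⟨
    (k + k) * a + (suc w + g + (suc w + g))
      ≡⟨ lem k a w g ⟩
    (k * a + w) + (k * a + w) + (2 + (g + g))
      ≡⟨ cong (λ z → z + z + (2 + (g + g))) eq ⟩
    tri n + tri n + (2 + (g + g))
      ≡⟨ cong (_+ (2 + (g + g))) (tri-double (y + (k + k))) ⟩
    suc (y + (k + k)) * (y + (k + k)) + (2 + (g + g)) ∎
    where
    open ≡-Reasoning
    lem : ∀ k a w g → (k + k) * a + (suc w + g + (suc w + g))
      ≡ (k * a + w) + (k * a + w) + (2 + (g + g))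
    lem = solve-∀
  -- For `y = a′ + 1 + f` the right side exceeds the left by an explicit positive amount unless `d`
  -- and `f` both vanish.
  tight : ∀ d f g k → let y = suc (k + k + d) + f ; m = y + (k + k) in
    (k + k) * (k + k + d + suc ((y + k) + (y + k))) + (m + m) ≡ suc m * m + (2 + (g + g)) →
    d ≡ 0 × f ≡ 0
  tight zero zero g k eq = refl , refl
  tight zero (suc f) g k eq = contradiction (trans (sym (lem f g k)) (sym eq)) (m+1+n≢m _)
    where
    lem : ∀ f g k → let y = suc (k + k + 0) + suc f ; m = y + (k + k) in
      suc m * m + (2 + (g + g)) ≡ (k + k) * (k + k + 0 + suc ((y + k) + (y + k))) + (m + m)
        + suc (1 + (g + g) + (f + 2) * (f + 1) + (k + k) + (k + k) * (f + f))
    lem = solve-∀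
  tight (suc d) f g k eq = contradiction (trans (sym (lem d f g k)) (sym eq)) (m+1+n≢m _)
    where
    lem : ∀ d f g k → let y = suc (k + k + suc d) + f ; m = y + (k + k) in
      suc m * m + (2 + (g + g)) ≡ (k + k) * (k + k + suc d + suc ((y + k) + (y + k))) + (m + m)
        + suc (1 + (g + g) + (d + f + 2) * (d + f + 1) + (k + k) * d + (k + k) * (f + f))
    lem = solve-∀
  cases : y ≤ a′ ⊎ a′ < y → Part (range 0 n) (w ∷ replicate k a)
  cases (inj₁ y≤a′) = subst (λ z → Part (range 0 n) (w ∷ z)) (map-replicate (_+ S) k a′)
    (lift (suc y) k (length-replicate k) seq (rec y≤a′ eq′))
  cases (inj₂ a′<y) with f , feq ← m≤n⇒∃[o]m+o≡n a′<y | g , geq ← m≤n⇒∃[o]m+o≡n w<m =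
    exceptional k n a w n-eq a-eq eq
    where
    small : d ≡ 0 × f ≡ 0
    small = tight d f g k (subst (λ y → let m = y + (k + k) in
      (k + k) * (k + k + d + suc ((y + k) + (y + k))) + (m + m) ≡ suc m * m + (2 + (g + g)))
      (sym feq) (doubled g geq))
    d≡0 = proj₁ small
    y-eq : y ≡ suc (k + k)
    y-eq = trans (sym feq) (trans (cong₂ (λ d f → suc (k + k + d) + f) d≡0 (proj₂ small)) (lem k))
      where
      lem : ∀ k → suc (k + k + 0) + 0 ≡ suc (k + k)
      lem = solve-∀
    n-eq : n ≡ suc (k + suc k) + (k + k)
    n-eq = trans (cong (λ y → suc y + (k + k)) y-eq) (cong (λ z → suc z + (k + k)) (sym (+-suc k k)))
    a-eq : a ≡ k + k + (3 + (k + k + (k + k) + (k + k)))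
    a-eq = trans (cong₂ (λ d y → k + k + d + suc ((y + k) + (y + k))) d≡0 y-eq) (lem k)
      where
      lem : ∀ k → k + k + 0 + suc ((suc (k + k) + k) + (suc (k + k) + k))
        ≡ k + k + (3 + (k + k + (k + k) + (k + k)))
      lem = solve-∀

-- Strong induction on `n`, with largest number m. If `m ≤ w`, then m goes into the bin `w`.
-- Otherwise the numbers from a - m to m are paired to sum `a` when `a ≤ 2m`, and every bin of size
-- `a` takes a top pair when `a > 2m`.
equalBins : ∀ n r a w → n ≤ suc a → r * a + w ≡ tri n → Part (range 0 n) (w ∷ replicate r a)
equalBins n = go n (<-wellFounded n)
  where
  go : ∀ n → Acc _<_ n → ∀ r a w → n ≤ suc a → r * a + w ≡ tri n →
    Part (range 0 n) (w ∷ replicate r a)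
  go n _ zero a w _ eq = single (range 0 n) (sym eq)
  go zero _ (suc r) a w _ eq
    with refl ← m+n≡0⇒n≡0 (a + r * a) eq
    with refl ← m+n≡0⇒m≡0 a (m+n≡0⇒m≡0 (a + r * a) eq) = zeros (suc (suc r))
  go (suc m) (acc rs) (suc r) a w (s≤s m≤a) eq with ≤-<-connex m w
  ... | inj₁ m≤w with w′ , refl ← m≤n⇒∃[o]m+o≡n m≤w =
    pourTop m (+-comm w′ m) (go m (rs ≤-refl) (suc r) a w′ (m≤n⇒m≤1+n m≤a) eq′)
    where
    lem : ∀ x m w → x + w + (m + 0) ≡ x + (m + w)
    lem = solve-∀
    eq′ : suc r * a + w′ ≡ tri m
    eq′ = +-cancelʳ-≡ (m + 0) _ _ (trans (lem (suc r * a) m w′) (trans eq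
      (trans (cong tri (+-comm 1 m)) (tri-+ m 1))))
  go (suc m) (acc rs) (suc r) a w (s≤s m≤a) eq | inj₂ w<m with ≤-<-connex a (m + m)
  ... | inj₁ a≤2m
    -- The new `n` is a - m, the partner of m. The block from `n` to m has `L + 1` numbers, and `L`
    -- has the same parity as `a`.
    with n , refl ← m≤n⇒∃[o]m+o≡n m≤a
    with L , refl ← m≤n⇒∃[o]m+o≡n (+-cancelˡ-≤ m _ _ a≤2m)
    with half L
  ... | N , inj₁ refl =
    subst₂ (λ n a → Part (range 0 n) (w ∷ replicate (suc r) a)) n-eq a-eq
      (evenStep n N (suc r) w (subst (w <_) (sym a-eq) (<-≤-trans w<m m≤a))
        (subst₂ (λ n a → suc r * a + w ≡ tri n) (sym n-eq) (sym a-eq) eq)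
        λ r′ eq′ → go n (rs (s≤s (m≤m+n n _))) r′ (n + N) w (m≤n⇒m≤1+n (m≤m+n n N)) eq′)
    where
    lem : ∀ n N → n + N + (n + N) ≡ n + (N + N) + n
    lem = solve-∀
    a-eq = lem n N
    n-eq : n + (N + suc N) ≡ suc (n + (N + N))
    n-eq = trans (cong (n +_) (+-suc N N)) (+-suc n (N + N))
  ... | N , inj₂ refl =
    subst (λ z → Part (range 0 z) (w ∷ replicate (suc r) (n + suc (N + N) + n))) n-eq
      (oddStep n (suc N) (suc r) _ w (lem n N) (<-≤-trans w<m m≤a) (trans eq (cong tri (sym n-eq)))
        λ r′ eq′ → go n (rs (s≤s (m≤m+n n _))) r′ _ w (m≤n⇒m≤1+n (m≤n+m n _)) eq′)
    where
    lem : ∀ n N → suc (n + suc (N + N) + n) ≡ n + (n + (suc N + suc N))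
    lem = solve-∀
    n-eq : n + (suc N + suc N) ≡ suc (n + suc (N + N))
    n-eq = trans (+-suc n (N + suc N)) (cong (λ z → suc (n + z)) (+-suc N N))
  go (suc m) (acc rs) (suc r) a w (s≤s m≤a) eq | inj₂ w<m | inj₂ 2m<a
    with y , refl ← m≤n⇒∃[o]m+o≡n (twiceBins≤top (suc r) m a w (≤-<-trans (m≤m+n m m) 2m<a) eq)
    with d , refl ← m≤n⇒∃[o]m+o≡n 2m<a =
    subst₂ (λ n a → Part (range 0 n) (w ∷ replicate (suc r) a)) n-eq a-eq
      (farStep r y d w (subst (w <_) (+-comm (k + k) y) w<m)
        (subst₂ (λ n a → suc r * a + w ≡ tri n) (sym n-eq) (sym a-eq) eq)
        λ y≤a eq′ → go (suc y) (rs (s≤s (m<n+m y z<s))) (suc r) _ w (s≤s y≤a) eq′)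
    where
    k = suc r
    lem : ∀ k y d → k + k + d + suc (y + k + (y + k)) ≡ suc (k + k + y + (k + k + y)) + d
    lem = solve-∀
    a-eq = lem k y d
    n-eq : suc y + (k + k) ≡ suc (k + k + y)
    n-eq = cong suc (+-comm y (k + k))

-- Bins of two consecutive sizes

twoSizes : ℕ → ℕ → ℕ → List ℕ
twoSizes b c q = replicate b q ++ replicate c (suc q)

-- From here on the additional first bin has size 0, so that `append`, `lift` and `pourTop`, stated
-- for one distinguished first bin, still apply.
zeroBins : ∀ b c q → b * q + c * suc q ≡ 0 → Part [] (0 ∷ twoSizes b c q)
zeroBins b c q eq
  with m*n≡0⇒m≡0∨n≡0 c (m+n≡0⇒n≡0 (b * q) eq)
     | m*n≡0⇒m≡0∨n≡0 b (m+n≡0⇒m≡0 (b * q) eq)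
... | inj₁ refl | inj₁ refl = zeros 1
... | inj₁ refl | inj₂ refl = Part-++ (zeros (suc b)) empty

leadingZero : Part xs ts → Part xs (0 ∷ ts)
leadingZero = fill [] refl refl

-- The number h left over by the block is completed by w to a bin of size u.
finishEqual : ∀ n L s r u h w ps → Part (range n L) (h ∷ ps ++ replicate s u) →
  w + h ≡ u → 0 < h → n ≤ suc u → r * u + sum ps ≡ tri (n + L) → Part (range 0 (n + L)) (0 ∷ ps ++ replicate r u)
finishEqual n L s r u h w ps block weq 0<h n≤u eq = finish (m≤n⇒∃[o]m+o≡n s<r)
  where
  total : r * u + sum ps ≡ tri n + (h + (sum ps + s * u))
  total = trans eq (trans (tri-block block) (cong (λ z → tri n + (h + z))
    (trans (sum-++ ps (replicate s u)) (cong (sum ps +_) (sum-replicate s u)))))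
  -- The positive number `h` lies outside the bins `ps` and the `s` pairs, so these cannot account
  -- for the whole total.
  s<r : s < r
  s<r = ≰⇒> λ r≤s → <-irrefl total (begin-strict
    r * u + sum ps                   ≤⟨ +-monoˡ-≤ (sum ps) (*-monoˡ-≤ u r≤s) ⟩
    s * u + sum ps                   ≡⟨ +-comm (s * u) (sum ps) ⟩
    sum ps + s * u                   <⟨ +-monoˡ-< (sum ps + s * u) 0<h ⟩
    h + (sum ps + s * u)             ≤⟨ m≤n+m _ (tri n) ⟩
    tri n + (h + (sum ps + s * u))   ∎)
    where open ≤-Reasoning
  finish : ∃[ r′ ] suc s + r′ ≡ r → Part (range 0 (n + L)) (0 ∷ ps ++ replicate r u)
  finish (r′ , refl) = leadingZero (Part-↭ʳ perm₂ (subst (λ z → Part _ (z ∷ R ++ ps ++ S)) weq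
      (merge (Part-↭ʳ perm₁ (append n L (equalBins n r′ u w n≤u eq′) block)))))
    where
    R = replicate r′ u
    S = replicate s u
    lem : ∀ s r u p h w → u + (s + r) * u + p + w ≡ r * u + w + (u + (p + s * u))
    lem = solve-∀
    lem₂ : ∀ t h p w → t + (h + p) + w ≡ t + ((w + h) + p)
    lem₂ = solve-∀
    eq′ : r′ * u + w ≡ tri n
    eq′ = +-cancelʳ-≡ (u + (sum ps + s * u)) _ _ (trans (sym (lem s r′ u (sum ps) h w))
      (trans (cong (_+ w) total) (trans (lem₂ (tri n) h _ w)
        (cong (λ z → tri n + (z + (sum ps + s * u))) weq))))
    open PermutationReasoning
    perm₁ : w ∷ R ++ h ∷ ps ++ S ↭ w ∷ h ∷ R ++ ps ++ S
    perm₁ = prep w (↭.shift h R (ps ++ S))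
    perm₂ : u ∷ R ++ ps ++ S ↭ ps ++ replicate (suc s + r′) u
    perm₂ = begin
      u ∷ R ++ ps ++ S    ↭⟨ ↭.shifts (u ∷ R) ps ⟩
      ps ++ u ∷ R ++ S    ↭⟨ ↭.++⁺ˡ ps (prep u (↭.++-comm R S)) ⟩
      ps ++ u ∷ S ++ R    ≡⟨ cong (λ z → ps ++ u ∷ z) (replicate-+ s r′ u) ⟨
      ps ++ replicate (suc s + r′) u ∎

-- q odd: q-pairs inside, (q + 1)-pairs outside.
mixedOdd : ∀ n s b c q → suc q ≡ (n + s + b) + (n + s + b) → let L = s + (b + b + 1 + s) in
  b * q + c * suc q ≡ tri (n + L) → Part (range 0 (n + L)) (0 ∷ twoSizes b c q)
mixedOdd n s b c q qeq eq =
  finishEqual n _ s c (suc q) h (n + s) (replicate b q)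
    (nest s n (b + b + 1) (suc q) (trans (cong suc qeq) (lem₁ n s b)) middle)
    (trans (lem₂ n s b) (sym qeq)) (n≢0⇒n>0 h≢0) n≤
    (trans (cong (c * suc q +_) (sum-replicate b q)) (trans (+-comm (c * suc q) (b * q)) eq))
  where
  -- The middle interval has `2b + 1` numbers. All but the last form `b` pairs of sum `q`; the last
  -- one is `h`.
  h = n + s + (b + b)
  lem₁ : ∀ n s b → suc ((n + s + b) + (n + s + b)) ≡ n + (n + (s + (b + b + 1 + s)))
  lem₁ = solve-∀
  lem₂ : ∀ n s b → n + s + (n + s + (b + b)) ≡ (n + s + b) + (n + s + b)
  lem₂ = solve-∀
  lem₃ : ∀ n s b → (n + s + b) + (n + s + b) ≡ (n + s) + ((n + s) + (b + (0 + b)))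
  lem₃ = solve-∀
  h≢0 : h ≢ 0
  h≢0 h≡0 with refl ← m+n≡0⇒m≡0 b (m+n≡0⇒n≡0 (n + s) h≡0) =
    0≢1+n (sym (trans qeq (cong (λ z → z + z) h≡0)))
  n≤ : n ≤ suc (suc q)
  n≤ = m≤n⇒m≤1+n (subst (n ≤_) (sym qeq)
    (≤-trans (≤-trans (m≤m+n n s) (m≤m+n (n + s) b)) (m≤m+n _ _)))
  middle : Part (range (n + s) (b + b + 1)) (h ∷ replicate b q)
  middle = subst (λ z → Part z (h ∷ replicate b q)) (sym (range-++ (n + s) (b + b) 1))
    (Part-↭ʳ (↭.++-comm (replicate b q) [ h ])
      (Part-++ (nest b (n + s) 0 q (trans qeq (lem₃ n s b)) empty) (single [ h ] (+-identityʳ h))))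

-- q even: (q + 1)-pairs inside, q-pairs outside.
mixedEven : ∀ n s b c q → q ≡ (n + suc s + c) + (n + suc s + c) →
  let L = suc s + (suc (c + c) + suc s) in
  b * q + c * suc q ≡ tri (n + L) → Part (range 0 (n + L)) (0 ∷ twoSizes b c q)
mixedEven n s b c q qeq eq =
  Part-↭ʳ (prep 0 (↭.++-comm (replicate c (suc q)) (replicate b q)))
    (finishEqual n _ (suc s) b q (n + suc s) w (replicate c (suc q))
      (nest (suc s) n (suc (c + c)) q (trans (cong suc qeq) (lem₁ n s c)) middle)
      (trans (lem₂ n s c) (sym qeq)) (<-≤-trans z<s (m≤n+m (suc s) n)) n≤
      (trans (cong (b * q +_) (sum-replicate c (suc q))) eq))
  where
  -- Here the first number `n + suc s` of the middle interval is left over, and `w` is what it lacks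
  -- to `q`.
  w = n + suc s + (c + c)
  lem₁ : ∀ n s c → suc ((n + suc s + c) + (n + suc s + c)) ≡ n + (n + (suc s + (suc (c + c) + suc s)))
  lem₁ = solve-∀
  lem₂ : ∀ n s c → n + suc s + (c + c) + (n + suc s) ≡ (n + suc s + c) + (n + suc s + c)
  lem₂ = solve-∀
  lem₃ : ∀ n s c → suc (suc ((n + suc s + c) + (n + suc s + c)))
    ≡ suc (n + suc s) + (suc (n + suc s) + (c + (0 + c)))
  lem₃ = solve-∀
  n≤ : n ≤ suc q
  n≤ = m≤n⇒m≤1+n (subst (n ≤_) (sym qeq)
    (≤-trans (≤-trans (m≤m+n n (suc s)) (m≤m+n (n + suc s) c)) (m≤m+n _ _)))
  middle : Part (range (n + suc s) (suc (c + c))) (n + suc s ∷ replicate c (suc q))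
  middle = Part-++ {xs = [ n + suc s ]} (single _ (+-identityʳ (n + suc s)))
    (nest c (suc (n + suc s)) 0 (suc q) (trans (cong (λ z → suc (suc z)) qeq) (lem₃ n s c)) empty)

-- The analogue of `farStep` for q = 2m + d. There is no exceptional case: for `y > q′` the left
-- side of `doubled` exceeds the right by an explicit positive amount.
farBalanced : ∀ b c k y d → b + c ≡ suc k →
  let K = suc k + suc k
      S = suc ((y + suc k) + (y + suc k))
      q′ = suc (k + k) + d
      q = q′ + S in
  b * q + c * suc q ≡ tri (suc y + K) →
  (y ≤ q′ → b * q′ + c * suc q′ ≡ tri (suc y) →
    Part (range 0 (suc y)) (0 ∷ twoSizes b c q′)) →
  Part (range 0 (suc y + K)) (0 ∷ twoSizes b c q)
farBalanced b c k y d keq eq rec =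
  subst (λ z → Part (range 0 (suc y + K)) (0 ∷ z)) shape
    (lift (suc y) (suc k) len seq (rec y≤q′ eq′))
  where
  K = suc k + suc k
  m = y + K
  S = suc ((y + suc k) + (y + suc k))
  q′ = suc (k + k) + d
  q = q′ + S
  B = replicate b q′
  C = replicate c (suc q′)
  len : length (B ++ C) ≡ suc k
  len = trans (length-++ B) (trans (cong₂ _+_ (length-replicate b) (length-replicate c)) keq)
  shape : map (_+ S) (B ++ C) ≡ replicate b q ++ replicate c (suc q)
  shape = trans (map-++ (_+ S) B C)
    (cong₂ _++_ (map-replicate (_+ S) b q′) (map-replicate (_+ S) c (suc q′)))
  seq : suc S ≡ suc y + (suc y + K)
  seq = lem k y
    where
    lem : ∀ k y → suc (suc ((y + suc k) + (y + suc k))) ≡ suc y + (suc y + (suc k + suc k))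
    lem = solve-∀
  eq′ : b * q′ + c * suc q′ ≡ tri (suc y)
  eq′ = +-cancelʳ-≡ ((b + c) * S) _ _ (trans (sym (lem b c q′ S)) (trans eq
    (trans (tri-lift S (suc y) (suc k) seq) (cong (λ z → tri (suc y) + z * S) (sym keq)))))
    where
    lem : ∀ b c q S → b * (q + S) + c * suc (q + S) ≡ b * q + c * suc q + (b + c) * S
    lem = solve-∀
  doubled : suc m * m + (b + b) ≡ K * suc q
  doubled = begin
    suc m * m + (b + b)               ≡⟨ cong (_+ (b + b)) (tri-double m) ⟨
    tri (suc m) + tri (suc m) + (b + b) ≡⟨ cong (λ z → z + z + (b + b)) eq ⟨
    b * q + c * suc q + (b * q + c * suc q) + (b + b) ≡⟨ lem b c q ⟩
    ((b + c) + (b + c)) * suc q  ≡⟨ cong (λ z → (z + z) * suc q) keq ⟩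
    K * suc q ∎
    where
    open ≡-Reasoning
    lem : ∀ b c q → b * q + c * suc q + (b * q + c * suc q) + (b + b)
      ≡ ((b + c) + (b + c)) * suc q
    lem = solve-∀
  y≤q′ : y ≤ q′
  y≤q′ = ≮⇒≥ λ q′<y → let f , feq = m≤n⇒∃[o]m+o≡n q′<y in
    contradiction (trans (sym (lem b k d f)) (subst (λ y →
        suc (y + K) * (y + K) + (b + b) ≡ K * suc (q′ + suc ((y + suc k) + (y + suc k))))
        (sym feq) doubled))
      (m+1+n≢m _)
    where
    lem : ∀ b k d f → let K = suc k + suc k; q′ = suc (k + k) + d; y = suc q′ + f; m = y + K in
      suc m * m + (b + b) ≡ K * suc (q′ + suc ((y + suc k) + (y + suc k)))
        + suc (1 + (b + b) + (k + k) + K * d + (K + K) * f + (d + f) * (d + f) + d + f)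
    lem = solve-∀

-- The case of enough bins of size `t`: all pairs of the block fill such bins, and the numbers below
-- `n` are left to the induction.
peel : ∀ n N r t ts → suc t ≡ n + (n + (N + N)) → (N + r) * t + sum ts ≡ tri (n + (N + N)) →
  (r * t + sum ts ≡ tri n → Part (range 0 n) (0 ∷ replicate r t ++ ts)) →
  Part (range 0 (n + (N + N))) (0 ∷ replicate (N + r) t ++ ts)
peel n N r t ts teq eq rec =
  Part-↭ʳ (prep 0 perm) (append n (N + N) (rec eq′) (nest N n 0 t teq empty))
  where
  lem : ∀ N r t s → (N + r) * t + s ≡ r * t + s + N * t
  lem = solve-∀
  eq′ : r * t + sum ts ≡ tri n
  eq′ = +-cancelʳ-≡ (N * t) _ _ (trans (sym (lem N r t (sum ts))) (trans eq (tri-lift t n N teq)))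
  open PermutationReasoning
  perm : (replicate r t ++ ts) ++ replicate N t ↭ replicate (N + r) t ++ ts
  perm = begin
    (replicate r t ++ ts) ++ replicate N t  ↭⟨ ↭.++-comm (replicate r t ++ ts) (replicate N t) ⟩
    replicate N t ++ replicate r t ++ ts    ≡⟨ ++-assoc (replicate N t) (replicate r t) ts ⟨
    (replicate N t ++ replicate r t) ++ ts  ≡⟨ cong (_++ ts) (replicate-+ N r t) ⟨
    replicate (N + r) t ++ ts               ∎

-- Strong induction on `n`, with largest number m: pairing within an interval ending at m for
-- `q < 2m`, a top pair for every bin for `q ≥ 2m`.
balancedBins : ∀ n b c q → n ≤ suc q → b * q + c * suc q ≡ tri n →
  Part (range 0 n) (0 ∷ twoSizes b c q)
balancedBins n = go n (<-wellFounded n)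
  where
  go : ∀ n → Acc _<_ n → ∀ b c q → n ≤ suc q → b * q + c * suc q ≡ tri n →
    Part (range 0 n) (0 ∷ twoSizes b c q)
  go zero _ b c q _ eq = zeroBins b c q eq
  go (suc zero) _ b c q _ eq = pourTop 0 refl (zeroBins b c q eq)
  go (suc m) (acc rs) b c q (s≤s m≤q) eq with <-≤-connex q (m + m)
  ... | inj₁ q<2m
    with n , refl ← m≤n⇒∃[o]m+o≡n m≤q
    with L , refl ← m≤n⇒∃[o]m+o≡n (+-cancelˡ-< m _ _ q<2m)
    with half L
  -- `q = 2n + 2N + 1` is odd, and the numbers from `n = q − m` to m form `N + 1` pairs of sum `q`.
  ... | N , inj₁ refl =
    subst (λ z → Part (range 0 z) (0 ∷ twoSizes b c q)) n-eq (cases (<-≤-connex b (suc N)))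
    where
    n-eq : n + (suc N + suc N) ≡ suc (suc (n + (N + N)))
    n-eq = lem n N
      where
      lem : ∀ n N → n + (suc N + suc N) ≡ suc (suc (n + (N + N)))
      lem = solve-∀
    cases : b < suc N ⊎ suc N ≤ b → Part (range 0 (n + (suc N + suc N))) (0 ∷ twoSizes b c q)
    -- Fewer bins of size `q` than pairs. The outer pairs have sum `q + 1`, so their interval starts
    -- one higher, at `suc n`.
    cases (inj₁ b≤N) with s , refl ← m≤n⇒∃[o]m+o≡n (s≤s⁻¹ b≤N) =
      subst (λ z → Part (range 0 z) (0 ∷ twoSizes b c q)) (lem₁ n b s)
        (mixedOdd (suc n) s b c q (lem₂ n b s) (trans eq (cong tri (trans (sym n-eq) (sym (lem₁ n b s))))))
      where
      lem₁ : ∀ n b s → suc n + (s + (b + b + 1 + s)) ≡ n + (suc (b + s) + suc (b + s))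
      lem₁ = solve-∀
      lem₂ : ∀ n b s → suc (suc (n + ((b + s) + (b + s))) + n) ≡ (suc n + s + b) + (suc n + s + b)
      lem₂ = solve-∀
    cases (inj₂ N<b) with b′ , refl ← m≤n⇒∃[o]m+o≡n N<b =
      peel n (suc N) b′ q (replicate c (suc q)) (lem n N)
        (trans (cong ((suc N + b′) * q +_) (sum-replicate c (suc q))) (trans eq (cong tri (sym n-eq))))
        λ eq′ → go n (rs (s≤s (m≤n⇒m≤1+n (m≤m+n n _)))) b′ c q (m≤n⇒m≤1+n (m≤n+m n _))
          (trans (cong (b′ * q +_) (sym (sum-replicate c (suc q)))) eq′)
      where
      lem : ∀ n N → suc (suc (n + (N + N)) + n) ≡ n + (n + (suc N + suc N))
      lem = solve-∀
  -- `q = 2n + 2N + 2` is even, so the pairs have sum `q + 1` and start at `suc n`.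
  go (suc m) (acc rs) b c q (s≤s m≤q) eq | inj₁ q<2m | N , inj₂ refl =
    subst (λ z → Part (range 0 z) (0 ∷ twoSizes b c q)) n-eq (cases (<-≤-connex c (suc N)))
    where
    n-eq : suc n + (suc N + suc N) ≡ suc (suc (n + suc (N + N)))
    n-eq = lem n N
      where
      lem : ∀ n N → suc n + (suc N + suc N) ≡ suc (suc (n + suc (N + N)))
      lem = solve-∀
    cases : c < suc N ⊎ suc N ≤ c → Part (range 0 (suc n + (suc N + suc N))) (0 ∷ twoSizes b c q)
    cases (inj₁ c≤N) with s , refl ← m≤n⇒∃[o]m+o≡n (s≤s⁻¹ c≤N) =
      subst (λ z → Part (range 0 z) (0 ∷ twoSizes b c q)) (lem₁ n c s)
        (mixedEven n s b c q (lem₂ n c s) (trans eq (cong tri (trans (sym n-eq) (sym (lem₁ n c s))))))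
      where
      lem₁ : ∀ n c s → n + (suc s + (suc (c + c) + suc s)) ≡ suc n + (suc (c + s) + suc (c + s))
      lem₁ = solve-∀
      lem₂ : ∀ n c s → suc (n + suc ((c + s) + (c + s))) + n ≡ (n + suc s + c) + (n + suc s + c)
      lem₂ = solve-∀
    cases (inj₂ N<c) with c′ , refl ← m≤n⇒∃[o]m+o≡n N<c =
      Part-↭ʳ (prep 0 (↭.++-comm (replicate c (suc q)) (replicate b q)))
        (peel (suc n) (suc N) c′ (suc q) (replicate b q) (lem n N)
          (trans (cong (c * suc q +_) (sum-replicate b q))
            (trans (+-comm (c * suc q) (b * q)) (trans eq (cong tri (sym n-eq)))))
          λ eq′ → Part-↭ʳ (prep 0 (↭.++-comm (replicate b q) (replicate c′ (suc q))))
            (go (suc n) (rs (s≤s (s≤s (m≤m+n n _)))) b c′ q (s≤s (m≤n+m n _))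
              (trans (+-comm (b * q) (c′ * suc q))
                (trans (cong (c′ * suc q +_) (sym (sum-replicate b q))) eq′))))
      where
      lem : ∀ n N → suc (suc (suc (n + suc (N + N)) + n)) ≡ suc n + (suc n + (suc N + suc N))
      lem = solve-∀
  go (suc zero) _ b c q _ eq | inj₂ _ = pourTop 0 refl (zeroBins b c q eq)
  go (suc m@(suc _)) (acc rs) b c q (s≤s m≤q) eq | inj₂ 2m≤q = far (b + c) refl
    where
    -- The same total seen as `k` bins of size `q` and one of size `c`, the form that
    -- `twiceBins≤top` expects.
    bound-eq : ∀ k → b + c ≡ k → k * q + c ≡ tri (suc m)
    bound-eq _ refl = trans (lem b c q) eq
      where
      lem : ∀ b c q → (b + c) * q + c ≡ b * q + c * suc q
      lem = solve-∀
    far : ∀ k → b + c ≡ k → Part (range 0 (suc m)) (0 ∷ twoSizes b c q)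
    far zero keq with () ← subst₂ (λ b c → b * q + c * suc q ≡ tri (suc m))
      (m+n≡0⇒m≡0 b keq) (m+n≡0⇒n≡0 b keq) eq
    far (suc k) keq
      with y , yeq ← m≤n⇒∃[o]m+o≡n (twiceBins≤top (suc k) m q c
        (<-≤-trans (m<m+n m z<s) 2m≤q) (bound-eq (suc k) keq))
      with d , refl ← m≤n⇒∃[o]m+o≡n 2m≤q =
      subst₂ (λ n q → Part (range 0 n) (0 ∷ twoSizes b c q)) n-eq q-eq
        (farBalanced b c k y d keq
          (subst₂ (λ n q → b * q + c * suc q ≡ tri n) (sym n-eq) (sym q-eq) eq)
          λ y≤q eq′ →
            go (suc y) (rs (subst (suc y <_) n-eq (s≤s (m<m+n y z<s)))) b c _ (s≤s y≤q) eq′)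
      where
      n-eq : suc y + (suc k + suc k) ≡ suc m
      n-eq = cong suc (trans (+-comm y (suc k + suc k)) yeq)
      q-eq : suc (k + k) + d + suc ((y + suc k) + (y + suc k)) ≡ q
      q-eq = trans (lem k y d) (cong (λ m → m + m + d) yeq)
        where
        lem : ∀ k y d → suc (k + k) + d + suc ((y + suc k) + (y + suc k))
          ≡ (suc k + suc k + y) + (suc k + suc k + y) + d
        lem = solve-∀

-- From a partition of range 0 n to a colouring

open import Data.Fin.Base using (zero; suc)

private
  variable
    n k : ℕ

weightIf : Fin k → ℕ × Fin k → ℕ
weightIf a (x , d) = if does (d ≟ a) then x else 0

weight : Fin k → List (ℕ × Fin k) → ℕ
weight a ps = sum (map (weightIf a) ps)

weight-++ : ∀ (a : Fin k) ps qs → weight a (ps ++ qs) ≡ weight a ps + weight a qs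
weight-++ a ps qs = trans (cong sum (map-++ (weightIf a) ps qs)) (sum-++ (map (weightIf a) ps) _)

-- Each number is tagged with the index of its bin. `↭-map-inv` carries the tags along the
-- permutation stored in `fill`, so the numbers need not be distinct.
tag : Part xs ts →
  ∃[ ps ] (map proj₁ ps ≡ xs × ∀ (a : Fin (length ts)) → weight a ps ≡ lookup ts a)
tag empty = [] , refl , λ ()
tag {ts = _ ∷ ts} (fill {xs = xs} {zs = zs} {t = t} ws eq τ p) with tag p
... | ps , ps-xs , ps-weight = qs , sym zs≡ , λ a →
    trans (sym (sum-↭ (↭.map⁺ (weightIf a) σ))) (weight-eq a)
  where
  new old rs : List (ℕ × Fin (suc (length ts)))
  new = map (_, zero) ws
  old = map (map₂ suc) ps
  rs = new ++ old
  proj₁-new : ∀ ws → map proj₁ (map (λ x → x , zero {length ts}) ws) ≡ ws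
  proj₁-new [] = refl
  proj₁-new (w ∷ ws) = cong (w ∷_) (proj₁-new ws)
  rs-zs : map proj₁ rs ↭ zs
  rs-zs = subst (_↭ zs) (sym (trans (map-++ proj₁ new old)
    (cong₂ _++_ (proj₁-new ws) (trans (sym (map-∘ ps)) ps-xs)))) τ
  qs = proj₁ (↭.↭-map-inv proj₁ rs-zs)
  zs≡ : zs ≡ map proj₁ qs
  zs≡ = proj₁ (proj₂ (↭.↭-map-inv proj₁ rs-zs))
  σ : rs ↭ qs
  σ = proj₂ (proj₂ (↭.↭-map-inv proj₁ rs-zs))
  new-zero : ∀ ws → weight (zero {length ts}) (map (_, zero) ws) ≡ sum ws
  new-zero [] = refl
  new-zero (w ∷ ws) = cong (w +_) (new-zero ws)
  new-suc : ∀ (a : Fin (length ts)) ws → weight (suc a) (map (_, zero) ws) ≡ 0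
  new-suc a [] = refl
  new-suc a (w ∷ ws) = new-suc a ws
  old-zero : ∀ (ps : List (ℕ × Fin (length ts))) → weight zero (map (map₂ suc) ps) ≡ 0
  old-zero [] = refl
  old-zero (_ ∷ ps) = old-zero ps
  weight-eq : ∀ a → weight a rs ≡ lookup (t ∷ ts) a
  weight-eq zero = trans (weight-++ zero new old)
    (trans (cong₂ _+_ (new-zero ws) (old-zero ps)) (trans (+-identityʳ _) eq))
  weight-eq (suc a) = trans (weight-++ (suc a) new old)
    (trans (cong₂ _+_ (new-suc a ws) (cong sum (sym (map-∘ ps)))) (ps-weight a))

-- As the numbers run through an interval in order, the tags form a function of the position, which
-- will be the colour of a vertex.
untabulate : ∀ lo n (ps : List (ℕ × Fin k)) → map proj₁ ps ≡ range lo n →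
  Σ[ f ∈ (Fin n → Fin k) ] ps ≡ tabulate (λ i → lo + toℕ i , f i)
untabulate lo zero [] eq = (λ ()) , refl
untabulate {k} lo (suc n) ((x , d) ∷ ps) eq
  with refl ← ∷-injectiveˡ eq
  with g , refl ← untabulate (suc lo) n ps (∷-injectiveʳ eq) =
  f , cong₂ _∷_ (cong (_, d) (sym (+-identityʳ lo)))
        (tabulate-cong λ i → cong (_, g i) (sym (+-suc lo (toℕ i))))
  where
  f : Fin (suc n) → Fin k
  f zero = d
  f (suc i) = g i

-- Colouring edges by their larger endpoint

max : Fin n → Fin n → Fin n
max i j = fromℕ< (⊔-pres-<m (toℕ<n i) (toℕ<n j))

toℕ-max : ∀ (i j : Fin n) → toℕ (max i j) ≡ toℕ i ⊔ toℕ j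
toℕ-max i j = toℕ-fromℕ< _

max-comm : ∀ (i j : Fin n) → max i j ≡ max j i
max-comm i j = fromℕ<-cong _ _ (⊔-comm (toℕ i) (toℕ j)) _ _

maxColoring : (Fin n → Fin k) → Coloring n k
maxColoring f = record { color = λ i j → f (max i j) ; color-sym = λ i j → cong f (max-comm i j) }

-- Two edges of each triangle share their larger endpoint.
maxColoring-Gallai : (f : Fin n → Fin k) → Gallai (maxColoring f)
maxColoring-Gallai f x y z _ _ _ (xy≢yz , yz≢xz , xy≢xz) =
  go (≤-total a b) (≤-total b c) (≤-total a c)
  where
  a = toℕ x
  b = toℕ y
  c = toℕ z
  same : ∀ i j k l → toℕ i ⊔ toℕ j ≡ toℕ k ⊔ toℕ l → f (max i j) ≡ f (max k l)
  same i j k l eq = cong f (fromℕ<-cong _ _ eq _ _)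
  go : a ≤ b ⊎ b ≤ a → b ≤ c ⊎ c ≤ b → a ≤ c ⊎ c ≤ a → _
  go (inj₁ a≤b) (inj₁ b≤c) _ = yz≢xz (same y z x z
    (trans (m≤n⇒m⊔n≡n b≤c) (sym (m≤n⇒m⊔n≡n (≤-trans a≤b b≤c)))))
  go (inj₁ a≤b) (inj₂ c≤b) _ = xy≢yz (same x y y z
    (trans (m≤n⇒m⊔n≡n a≤b) (sym (m≥n⇒m⊔n≡m c≤b))))
  go (inj₂ b≤a) _ (inj₁ a≤c) = yz≢xz (same y z x z
    (trans (m≤n⇒m⊔n≡n (≤-trans b≤a a≤c)) (sym (m≤n⇒m⊔n≡n a≤c))))
  go (inj₂ b≤a) _ (inj₂ c≤a) = xy≢xz (same x y x z
    (trans (m≥n⇒m⊔n≡m b≤a) (sym (m≥n⇒m⊔n≡m c≤a))))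

-- Counting the edges of a colour class

sum-tabulate : ∀ (g : Fin n → ℕ) → sum (tabulate g) ≡ ∑ g
sum-tabulate {zero} g = refl
sum-tabulate {suc n} g = cong (g zero +_) (sum-tabulate (g ∘ suc))

sum-allFin : ∀ (g : Fin n → ℕ) → sum (map g (allFin n)) ≡ ∑ g
sum-allFin g = trans (cong sum (map-tabulate id g)) (sum-tabulate g)

module _ {A : Set} {P Q : A → Set} (P? : Decidable P) (Q? : Decidable Q) where

  indicator : A → ℕ
  indicator x = if does (P? x) then (if does (Q? x) then 1 else 0) else 0

  length-filter-filter : ∀ xs → length (filter Q? (filter P? xs)) ≡ sum (map indicator xs)
  length-filter-filter [] = refl
  length-filter-filter (x ∷ xs) with P? x
  ... | no _ = length-filter-filter xs
  ... | yes _ with Q? x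
  ...   | no _ = length-filter-filter xs
  ...   | yes _ = cong suc (length-filter-filter xs)

sum-cartesianProduct : ∀ {A B : Set} (g : A × B → ℕ) xs ys →
  sum (map g (cartesianProduct xs ys)) ≡ sum (map (λ x → sum (map (λ y → g (x , y)) ys)) xs)
sum-cartesianProduct g [] ys = refl
sum-cartesianProduct g (x ∷ xs) ys =
  trans (cong sum (map-++ g (map (x ,_) ys) _))
    (trans (sum-++ (map g (map (x ,_) ys)) _)
      (cong₂ _+_ (cong sum (sym (map-∘ ys))) (sum-cartesianProduct g xs ys)))

∑-below : ∀ (j : Fin n) v → ∑ (λ (i : Fin n) → if does (i <? j) then v else 0) ≡ toℕ j * v
∑-below {suc n} zero v = sum-replicate-zero (suc n)
∑-below {suc n} (suc j) v = cong (v +_) (∑-below j v)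

classSize-maxColoring : ∀ (f : Fin n → Fin k) a →
  classSize (maxColoring f) a ≡ weight a (tabulate (λ i → toℕ i , f i))
classSize-maxColoring {n} f a = begin
  classSize (maxColoring f) a
    ≡⟨ length-filter-filter (λ (i , j) → i <? j) (λ (i , j) → f (max i j) ≟ a)
         (cartesianProduct (allFin n) (allFin n)) ⟩
  sum (map ind (cartesianProduct (allFin n) (allFin n)))
    ≡⟨ sum-cartesianProduct ind (allFin n) (allFin n) ⟩
  sum (map (λ i → sum (map (λ j → ind (i , j)) (allFin n))) (allFin n))
    ≡⟨ sum-allFin (λ i → sum (map (λ j → ind (i , j)) (allFin n))) ⟩
  ∑ (λ i → sum (map (λ j → ind (i , j)) (allFin n)))
    ≡⟨ sum-cong-≗ (λ i → sum-allFin (λ j → ind (i , j))) ⟩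
  ∑ (λ i → ∑ (λ j → ind (i , j)))
    -- The larger endpoint `j` is moved outside, since it alone determines the colour.
    ≡⟨ ∑-comm (λ i j → ind (i , j)) ⟩
  ∑ (λ j → ∑ (λ i → ind (i , j)))
    ≡⟨ sum-cong-≗ column ⟩
  ∑ (λ j → weightIf a (toℕ j , f j))
    ≡⟨ sum-tabulate (λ j → weightIf a (toℕ j , f j)) ⟨
  sum (tabulate (λ j → weightIf a (toℕ j , f j)))
    ≡⟨ cong sum (map-tabulate (λ i → toℕ i , f i) (weightIf a)) ⟨
  weight a (tabulate (λ i → toℕ i , f i)) ∎
  where
  open ≡-Reasoning
  ind : Fin n × Fin n → ℕ
  ind = indicator (λ (i , j) → i <? j) (λ (i , j) → f (max i j) ≟ a)
  v : Fin n → ℕ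
  v j = if does (f j ≟ a) then 1 else 0
  -- Where `i < j`, `max i j` is `j`, so the indicator no longer depends on the colour of `i`.
  entry : ∀ i j → ind (i , j) ≡ (if does (i <? j) then v j else 0)
  entry i j with toℕ i <ᵇ toℕ j in eq
  ... | false = refl
  ... | true = cong (λ l → if does (f l ≟ a) then 1 else 0)
    (toℕ-injective (trans (toℕ-max i j) (m≤n⇒m⊔n≡n (<⇒≤ i<j))))
    where
    i<j : toℕ i < toℕ j
    i<j = <ᵇ⇒< (toℕ i) (toℕ j) (subst T (sym eq) tt)
  scale : ∀ j → toℕ j * v j ≡ weightIf a (toℕ j , f j)
  scale j with f j ≟ a
  ... | no _ = *-zeroʳ (toℕ j)
  ... | yes _ = *-identityʳ (toℕ j)
  column : ∀ j → ∑ (λ i → ind (i , j)) ≡ weightIf a (toℕ j , f j)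
  column j = trans (sum-cong-≗ (λ i → entry i j)) (trans (∑-below j (v j)) (scale j))

coloringOf : Part (range 0 n) ts →
  ∃[ c ] (Gallai {n} {length ts} c × (∀ a → classSize c a ≡ lookup ts a))
coloringOf {n} p with ps , ps-range , ps-weight ← tag p with f , refl ← untabulate 0 n ps ps-range =
  maxColoring f , maxColoring-Gallai f , λ a → trans (classSize-maxColoring f a) (ps-weight a)

-- Balance, and the two cases of the theorem

NearlyEqual : ℕ → ℕ → Set
NearlyEqual q t = q ≤ t × t ≤ suc q

-- Sorting permutes the sizes, so the largest and the smallest are again `q` or `q + 1`.
balanced : ∀ .{{_ : NonZero k}} (c : Coloring n k) q →
  (∀ a → NearlyEqual q (classSize c a)) → Balanced c
balanced {k = suc k} c q near =
  ≤-trans (∸-mono (proj₂ (near-e zero)) (proj₁ (near-e (fromℕ k)))) (≤-reflexive (m+n∸n≡m 1 q))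
  where
  near-sorted : All (NearlyEqual q) (sortedSizes c)
  near-sorted = ↭.All-resp-↭ (↭-sym (sort-↭ (map (classSize c) (allFin (suc k)))))
    (map⁺ (All.universal near (allFin (suc k))))
  near-e : ∀ i → NearlyEqual q (e c i)
  near-e i = All.lookup near-sorted (∈-lookup (cast (sym (length-sortedSizes c)) i))

balancedColoring : ∀ .{{_ : NonZero k}} q → length ts ≡ k → All (NearlyEqual q) ts →
  Part (range 0 n) ts →
  ∃[ c ] (Gallai {n} {k} c × Balanced c)
balancedColoring q refl near p with c , gallai , sizes ← coloringOf p =
  c , gallai , balanced c q λ a → subst (NearlyEqual q) (sym (sizes a)) (All.lookup near (∈-lookup a))

-- The bin of size 0 may contain the number 0, so it is merged into the next bin instead of being
-- discarded.
dropZero : 0 < length ts → Part xs (0 ∷ ts) → Part xs ts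
dropZero {ts = _ ∷ _} _ p = merge p

-- For positive `j` the largest number `2j` is one more than the common sum `2j − 1` of the pairs.
tightBins : ∀ j → ∃[ q ] ∃[ t ] (NearlyEqual q t × Part (range 0 (j + suc j)) (t ∷ replicate j q))
tightBins zero = 0 , 0 , (z≤n , z≤n) , single (range 0 1) refl
tightBins (suc i) = q , suc q , (n≤1+n q , ≤-refl) ,
  subst (λ z → Part (range 0 z) (suc q ∷ replicate (suc i) q)) (sym (+-suc (suc i) (suc i)))
    (pourTop (suc i + suc i) refl (leadingZero (nest (suc i) 0 0 q refl empty)))
  where
  q = i + suc i

-- A quotient below `m` would make twice the total less than `m * (k + k) ≤ m * suc m`. This
-- supplies the size hypothesis of `balancedBins`.
average≥ : ∀ m k .{{_ : NonZero k}} → k + k ≤ suc m → m ≤ tri (suc m) / k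
average≥ m k 2k≤n = subst (_≤ tri (suc m) / k) (m*n/n≡m m k) (/-monoˡ-≤ k (≮⇒≥ λ lt →
  <-irrefl (tri-double m) (begin-strict
    tri (suc m) + tri (suc m)  <⟨ +-mono-< lt lt ⟩
    m * k + m * k              ≡⟨ *-distribˡ-+ m k k ⟨
    m * (k + k)                ≤⟨ *-monoʳ-≤ m 2k≤n ⟩
    m * suc m                  ≡⟨ *-comm m (suc m) ⟩
    suc m * m                  ∎)))
  where open ≤-Reasoning

double-≤ : ∀ n k → k ≤ ⌈ n /2⌉ → k + k ≤ suc n
double-≤ n k k≤ = begin
  k + k                      ≤⟨ +-mono-≤ k≤ (≤-trans k≤ (⌊n/2⌋≤⌈n/2⌉ (suc n))) ⟩
  ⌊ suc n /2⌋ + ⌈ suc n /2⌉  ≡⟨ ⌊n/2⌋+⌈n/2⌉≡n (suc n) ⟩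
  suc n                      ∎
  where open ≤-Reasoning

theorem3 : ∀ (n k : ℕ) .{{_ : NonZero n}} .{{_ : NonZero k}} →
    k ≤ ⌈ n /2⌉ → ∃[ c ] (Gallai {n} {k} c × Balanced c)
theorem3 n@(suc m) k@(suc j) k≤ with m≤n⇒m<n∨m≡n (double-≤ n k k≤)
... | inj₂ 2k≡1+n with q , t , near , p ← tightBins j =
  balancedColoring q (cong suc (length-replicate j)) (near ∷ replicate⁺ j (≤-refl , n≤1+n q))
    (subst (λ z → Part (range 0 z) (t ∷ replicate j q)) (suc-injective 2k≡1+n) p)
-- The remainder `c` of `tri n` modulo `k` is the number of bins of size `q + 1`.
... | inj₁ (s≤s 2k≤n) with b , c+b≡k ← m≤n⇒∃[o]m+o≡n (<⇒≤ (m%n<n (tri n) k)) =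
  balancedColoring q len
    (++⁺ (replicate⁺ b (≤-refl , n≤1+n q)) (replicate⁺ c (n≤1+n q , ≤-refl)))
    (dropZero (subst (0 <_) (sym len) z<s) (balancedBins n b c q (s≤s (average≥ m k 2k≤n)) total))
  where
  q = tri n / k
  c = tri n % k
  len : length (replicate b q ++ replicate c (suc q)) ≡ k
  len = trans (length-++ (replicate b q))
    (trans (cong₂ _+_ (length-replicate b) (length-replicate c)) (trans (+-comm b c) c+b≡k))
  lem : ∀ b c q → b * q + c * suc q ≡ c + q * (c + b)
  lem = solve-∀
  total : b * q + c * suc q ≡ tri n
  total = trans (lem b c q) (trans (cong (λ z → c + q * z) c+b≡k) (sym (m≡m%n+[m/n]*n (tri n) k)))
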